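{- Let $G$ be a graph, $k\ge1$ an integer, and $G_k$ the graph obtained from $G$ by cloning each vertex exactly $k-1$ times. Then, as polynomials, $$P(G_k;u,x)=P\big(G;u,(1+x)^k-1\big),$$ and consequently $$q(G_k;x,y)=q\Big(G;(x-1)\frac{y^k-1}{y-1}+1,\;y^k\Big).$$
   Context: All graphs are finite and undirected, without multiple edges but possibly with self loops. For $A\subseteq V$, $G[A]$ is the induced subgraph; $rk(G)$ is the $\mathbb{F}_2$-rank of the adjacency matrix $(m_{ij})$ ($m_{ij}=1$ iff $\{i,j\}\in E$; $m_{ii}=1$ iff $i$ has a self loop; empty graph: rank $0$). $q(G;x,y)=\sum_{A\subseteq V}(x-1)^{rk(G[A])}(y-1)^{|A|-rk(G[A])}$ and $P(G;u,x)=\sum_{A\subseteq V}x^{|A|}u^{rk(G[A])}$, with $0^0=1$; here $\frac{y^k-1}{y-1}=1+y+\dots+y^{k-1}$. The graph $G_k$ has vertex set $\{a_i: a\in V,\ 1\le i\le k\}$; for distinct $a,b\in V$, $a_i$ and $b_j$ are adjacent iff $\{a,b\}\in E$; $a_i,a_j$ are adjacent (for $i=j$: $a_i$ has a self loop) iff $a$ has a self loop in $G$. -}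

module Defs where

open import Algebra.Bundles using (CommutativeRing)
import Algebra.Definitions.RawMonoid as RawMonoidOps
import Algebra.Properties.CommutativeSemigroup as CommutativeSemigroupProps
import Algebra.Properties.Ring as RingProps
import Algebra.Properties.Semiring.Exp as SemiringExp
open import Data.Bool.Base using (Bool; true; false; _∧_)
import Data.Bool.Properties as Bool
open import Data.Fin.Base using (Fin; zero; suc; toℕ; quotient)
import Data.Fin.Properties as Fin
open import Data.Fin.Subset using (Subset; inside; outside; ∣_∣; _∉_)
open import Data.Fin.Subset.Properties using (anySubset?; _∈?_)
import Data.Integer.Properties as ℤ
open import Data.List.Base using (List; []; _∷_; _++_; map; filter; foldr)
open import Data.List.Extrema.Nat using (max)
open import Data.Nat.Base using (ℕ; zero; suc; _∸_) renaming (_*_ to _*ℕ_)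
open import Data.Product.Base using (∃; _,_)
open import Data.Vec.Base using (Vec; []; _∷_; lookup)
open import Level using (Level; _⊔_; 0ℓ)
open import Relation.Binary.PropositionalEquality.Core using (_≡_)
import Relation.Binary.Reasoning.Setoid as SetoidReasoning
open import Relation.Nullary.Negation.Core using (¬_)
open import Relation.Nullary.Decidable using (Dec; yes; no; ¬?; _→-dec_; decidable-stable)

-- A polynomial is its list of coefficients, constant term first; equality is
-- equality of all coefficients, so trailing zeros are irrelevant.

module Polynomial {c ℓ : Level} (R : CommutativeRing c ℓ) where

  open CommutativeRing R
  open RingProps ring using (-0#≈0#)
  open CommutativeSemigroupProps +-commutativeSemigroup using (interchange; x∙yz≈y∙xz)

  Poly : Set c
  Poly = List Carrier

  coeff : Poly → ℕ → Carrier
  coeff []      _       = 0#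
  coeff (a ∷ p) zero    = a
  coeff (a ∷ p) (suc i) = coeff p i

  infix  4 _≈ₚ_
  infixl 6 _+ₚ_
  infixl 7 _*ₚ_ _·ₚ_

  -- A record, so that the two polynomials can be inferred from the equation.
  record _≈ₚ_ (p q : Poly) : Set ℓ where
    constructor mk≈
    field at : ∀ i → coeff p i ≈ coeff q i
  open _≈ₚ_ public

  0ₚ 1ₚ var : Poly
  0ₚ  = []
  1ₚ  = 1# ∷ []
  var = 0# ∷ 1# ∷ []

  const : Carrier → Poly
  const a = a ∷ []

  _+ₚ_ : Poly → Poly → Poly
  []      +ₚ q       = q
  (a ∷ p) +ₚ []      = a ∷ p
  (a ∷ p) +ₚ (b ∷ q) = (a + b) ∷ (p +ₚ q)

  -ₚ_ : Poly → Poly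
  -ₚ_ = map (-_)

  _·ₚ_ : Carrier → Poly → Poly
  a ·ₚ p = map (a *_) p

  _*ₚ_ : Poly → Poly → Poly
  []      *ₚ q = []
  (a ∷ p) *ₚ q = a ·ₚ q +ₚ (0# ∷ p *ₚ q)

  private
    module ≈R = SetoidReasoning setoid

    coeff-+ : ∀ p q i → coeff (p +ₚ q) i ≈ coeff p i + coeff q i
    coeff-+ []      q       i       = sym (+-identityˡ _)
    coeff-+ (a ∷ p) []      i       = sym (+-identityʳ _)
    coeff-+ (a ∷ p) (b ∷ q) zero    = refl
    coeff-+ (a ∷ p) (b ∷ q) (suc i) = coeff-+ p q i

    coeff-neg : ∀ p i → coeff (-ₚ p) i ≈ - coeff p i
    coeff-neg []      i       = sym -0#≈0#
    coeff-neg (a ∷ p) zero    = refl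
    coeff-neg (a ∷ p) (suc i) = coeff-neg p i

    coeff-· : ∀ a p i → coeff (a ·ₚ p) i ≈ a * coeff p i
    coeff-· a []      i       = sym (zeroʳ a)
    coeff-· a (b ∷ p) zero    = refl
    coeff-· a (b ∷ p) (suc i) = coeff-· a p i

    ≈-refl : ∀ {p} → p ≈ₚ p
    ≈-refl = mk≈ λ _ → refl

    ≈-sym : ∀ {p q} → p ≈ₚ q → q ≈ₚ p
    ≈-sym e = mk≈ λ i → sym (at e i)

    ≈-trans : ∀ {p q r} → p ≈ₚ q → q ≈ₚ r → p ≈ₚ r
    ≈-trans e f = mk≈ λ i → trans (at e i) (at f i)

    shift-cong : ∀ {p q} → p ≈ₚ q → (0# ∷ p) ≈ₚ (0# ∷ q)
    shift-cong e = mk≈ λ { zero → refl ; (suc i) → at e i }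

    +-congₚ : ∀ {p p′ q q′} → p ≈ₚ p′ → q ≈ₚ q′ → p +ₚ q ≈ₚ p′ +ₚ q′
    +-congₚ {p} {p′} {q} {q′} e f = mk≈ λ i →
      trans (coeff-+ p q i) (trans (+-cong (at e i) (at f i)) (sym (coeff-+ p′ q′ i)))

    neg-cong : ∀ {p q} → p ≈ₚ q → -ₚ p ≈ₚ -ₚ q
    neg-cong {p} {q} e = mk≈ λ i →
      trans (coeff-neg p i) (trans (-‿cong (at e i)) (sym (coeff-neg q i)))

    ·-cong : ∀ {a p q} → p ≈ₚ q → a ·ₚ p ≈ₚ a ·ₚ q
    ·-cong {a} {p} {q} e = mk≈ λ i →
      trans (coeff-· a p i) (trans (*-congˡ (at e i)) (sym (coeff-· a q i)))

    +-assocₚ : ∀ p q r → (p +ₚ q) +ₚ r ≈ₚ p +ₚ (q +ₚ r)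
    +-assocₚ p q r = mk≈ λ i → begin
      coeff ((p +ₚ q) +ₚ r) i             ≈⟨ coeff-+ (p +ₚ q) r i ⟩
      coeff (p +ₚ q) i + coeff r i        ≈⟨ +-congʳ (coeff-+ p q i) ⟩
      (coeff p i + coeff q i) + coeff r i ≈⟨ +-assoc _ _ _ ⟩
      coeff p i + (coeff q i + coeff r i) ≈⟨ +-congˡ (coeff-+ q r i) ⟨
      coeff p i + coeff (q +ₚ r) i        ≈⟨ coeff-+ p (q +ₚ r) i ⟨
      coeff (p +ₚ (q +ₚ r)) i             ∎
      where open ≈R

    +-commₚ : ∀ p q → p +ₚ q ≈ₚ q +ₚ p
    +-commₚ p q = mk≈ λ i →
      trans (coeff-+ p q i) (trans (+-comm _ _) (sym (coeff-+ q p i)))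

    +-identityʳₚ : ∀ p → p +ₚ 0ₚ ≈ₚ p
    +-identityʳₚ p = +-commₚ p 0ₚ

    neg-inverseˡ : ∀ p → (-ₚ p) +ₚ p ≈ₚ 0ₚ
    neg-inverseˡ p = mk≈ λ i →
      trans (coeff-+ (-ₚ p) p i) (trans (+-congʳ (coeff-neg p i)) (-‿inverseˡ _))

    neg-inverseʳ : ∀ p → p +ₚ (-ₚ p) ≈ₚ 0ₚ
    neg-inverseʳ p = ≈-trans (+-commₚ p (-ₚ p)) (neg-inverseˡ p)

    shift-+ : ∀ p q → (0# ∷ (p +ₚ q)) ≈ₚ (0# ∷ p) +ₚ (0# ∷ q)
    shift-+ p q = mk≈ λ { zero → sym (+-identityˡ 0#) ; (suc i) → refl }

    shift-0 : (0# ∷ []) ≈ₚ 0ₚ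
    shift-0 = mk≈ λ { zero → refl ; (suc i) → refl }

    +-interchange : ∀ p q r s → (p +ₚ q) +ₚ (r +ₚ s) ≈ₚ (p +ₚ r) +ₚ (q +ₚ s)
    +-interchange p q r s = mk≈ λ i → begin
      coeff ((p +ₚ q) +ₚ (r +ₚ s)) i                    ≈⟨ coeff-+ (p +ₚ q) (r +ₚ s) i ⟩
      coeff (p +ₚ q) i + coeff (r +ₚ s) i               ≈⟨ +-cong (coeff-+ p q i) (coeff-+ r s i) ⟩
      (coeff p i + coeff q i) + (coeff r i + coeff s i) ≈⟨ interchange _ _ _ _ ⟩
      (coeff p i + coeff r i) + (coeff q i + coeff s i) ≈⟨ +-cong (coeff-+ p r i) (coeff-+ q s i) ⟨
      coeff (p +ₚ r) i + coeff (q +ₚ s) i               ≈⟨ coeff-+ (p +ₚ r) (q +ₚ s) i ⟨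
      coeff ((p +ₚ r) +ₚ (q +ₚ s)) i                    ∎
      where open ≈R

    ·-distrib-+ : ∀ a p q → a ·ₚ (p +ₚ q) ≈ₚ a ·ₚ p +ₚ a ·ₚ q
    ·-distrib-+ a p q = mk≈ λ i → begin
      coeff (a ·ₚ (p +ₚ q)) i             ≈⟨ coeff-· a (p +ₚ q) i ⟩
      a * coeff (p +ₚ q) i                ≈⟨ *-congˡ (coeff-+ p q i) ⟩
      a * (coeff p i + coeff q i)         ≈⟨ distribˡ a _ _ ⟩
      a * coeff p i + a * coeff q i       ≈⟨ +-cong (coeff-· a p i) (coeff-· a q i) ⟨
      coeff (a ·ₚ p) i + coeff (a ·ₚ q) i ≈⟨ coeff-+ (a ·ₚ p) (a ·ₚ q) i ⟨
      coeff (a ·ₚ p +ₚ a ·ₚ q) i          ∎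
      where open ≈R

    ·-assoc : ∀ a b p → (a * b) ·ₚ p ≈ₚ a ·ₚ (b ·ₚ p)
    ·-assoc a b p = mk≈ λ i → begin
      coeff ((a * b) ·ₚ p) i   ≈⟨ coeff-· (a * b) p i ⟩
      (a * b) * coeff p i      ≈⟨ *-assoc a b _ ⟩
      a * (b * coeff p i)      ≈⟨ *-congˡ (coeff-· b p i) ⟨
      a * coeff (b ·ₚ p) i     ≈⟨ coeff-· a (b ·ₚ p) i ⟨
      coeff (a ·ₚ (b ·ₚ p)) i  ∎
      where open ≈R

    ·-shift : ∀ a p → a ·ₚ (0# ∷ p) ≈ₚ (0# ∷ a ·ₚ p)
    ·-shift a p = mk≈ λ { zero → zeroʳ a ; (suc i) → refl }

    0·p : ∀ p → 0# ·ₚ p ≈ₚ 0ₚ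
    0·p p = mk≈ λ i → trans (coeff-· 0# p i) (zeroˡ _)

    1·p : ∀ p → 1# ·ₚ p ≈ₚ p
    1·p p = mk≈ λ i → trans (coeff-· 1# p i) (*-identityˡ _)

    *-congˡₚ : ∀ p {q r} → q ≈ₚ r → p *ₚ q ≈ₚ p *ₚ r
    *-congˡₚ []      e = ≈-refl
    *-congˡₚ (a ∷ p) e = +-congₚ (·-cong e) (shift-cong (*-congˡₚ p e))

    p*0 : ∀ p → p *ₚ 0ₚ ≈ₚ 0ₚ
    p*0 []      = ≈-refl
    p*0 (a ∷ p) = ≈-trans (shift-cong (p*0 p)) shift-0

    *-∷ : ∀ p b q → p *ₚ (b ∷ q) ≈ₚ b ·ₚ p +ₚ (0# ∷ p *ₚ q)
    *-∷ []      b q = ≈-sym shift-0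
    *-∷ (a ∷ p) b q = mk≈ λ
      { zero    → +-congʳ (*-comm a b)
      ; (suc i) → begin
          coeff (a ·ₚ q +ₚ p *ₚ (b ∷ q)) i
            ≈⟨ coeff-+ (a ·ₚ q) _ i ⟩
          coeff (a ·ₚ q) i + coeff (p *ₚ (b ∷ q)) i
            ≈⟨ +-congˡ (at (*-∷ p b q) i) ⟩
          coeff (a ·ₚ q) i + coeff (b ·ₚ p +ₚ (0# ∷ p *ₚ q)) i
            ≈⟨ +-congˡ (coeff-+ (b ·ₚ p) _ i) ⟩
          coeff (a ·ₚ q) i + (coeff (b ·ₚ p) i + coeff (0# ∷ p *ₚ q) i)
            ≈⟨ x∙yz≈y∙xz _ _ _ ⟩
          coeff (b ·ₚ p) i + (coeff (a ·ₚ q) i + coeff (0# ∷ p *ₚ q) i)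
            ≈⟨ +-congˡ (coeff-+ (a ·ₚ q) _ i) ⟨
          coeff (b ·ₚ p) i + coeff (a ·ₚ q +ₚ (0# ∷ p *ₚ q)) i
            ≈⟨ coeff-+ (b ·ₚ p) _ i ⟨
          coeff (b ·ₚ p +ₚ (a ·ₚ q +ₚ (0# ∷ p *ₚ q))) i ∎
      }
      where open ≈R

    *-commₚ : ∀ p q → p *ₚ q ≈ₚ q *ₚ p
    *-commₚ p []      = p*0 p
    *-commₚ p (b ∷ q) =
      ≈-trans (*-∷ p b q) (+-congₚ ≈-refl (shift-cong (*-commₚ p q)))

    *-congʳₚ : ∀ r {p q} → p ≈ₚ q → p *ₚ r ≈ₚ q *ₚ r
    *-congʳₚ r {p} {q} e =
      ≈-trans (*-commₚ p r) (≈-trans (*-congˡₚ r e) (*-commₚ r q))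

    *-congₚ : ∀ {p p′ q q′} → p ≈ₚ p′ → q ≈ₚ q′ → p *ₚ q ≈ₚ p′ *ₚ q′
    *-congₚ {p} {q′ = q′} e f = ≈-trans (*-congˡₚ p f) (*-congʳₚ q′ e)

    distribˡₚ : ∀ p q r → p *ₚ (q +ₚ r) ≈ₚ p *ₚ q +ₚ p *ₚ r
    distribˡₚ []      q r = ≈-refl
    distribˡₚ (a ∷ p) q r = ≈-trans
      (+-congₚ (·-distrib-+ a q r)
               (≈-trans (shift-cong (distribˡₚ p q r)) (shift-+ (p *ₚ q) (p *ₚ r))))
      (+-interchange (a ·ₚ q) (a ·ₚ r) (0# ∷ p *ₚ q) (0# ∷ p *ₚ r))

    distribʳₚ : ∀ r p q → (p +ₚ q) *ₚ r ≈ₚ p *ₚ r +ₚ q *ₚ r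
    distribʳₚ r p q = ≈-trans (*-commₚ (p +ₚ q) r)
      (≈-trans (distribˡₚ r p q) (+-congₚ (*-commₚ r p) (*-commₚ r q)))

    ·-*-assoc : ∀ a p q → (a ·ₚ p) *ₚ q ≈ₚ a ·ₚ (p *ₚ q)
    ·-*-assoc a []      q = ≈-refl
    ·-*-assoc a (b ∷ p) q = ≈-trans
      (+-congₚ (·-assoc a b q)
               (≈-trans (shift-cong (·-*-assoc a p q)) (≈-sym (·-shift a (p *ₚ q)))))
      (≈-sym (·-distrib-+ a (b ·ₚ q) (0# ∷ p *ₚ q)))

    shift-* : ∀ p q → (0# ∷ p) *ₚ q ≈ₚ (0# ∷ p *ₚ q)
    shift-* p q = +-congₚ (0·p q) ≈-refl

    *-assocₚ : ∀ p q r → (p *ₚ q) *ₚ r ≈ₚ p *ₚ (q *ₚ r)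
    *-assocₚ []      q r = ≈-refl
    *-assocₚ (a ∷ p) q r = ≈-trans
      (distribʳₚ r (a ·ₚ q) (0# ∷ p *ₚ q))
      (+-congₚ (·-*-assoc a q r)
               (≈-trans (shift-* (p *ₚ q) r) (shift-cong (*-assocₚ p q r))))

    *-identityˡₚ : ∀ p → 1ₚ *ₚ p ≈ₚ p
    *-identityˡₚ p = ≈-trans (+-congₚ (1·p p) shift-0) (+-identityʳₚ p)

    *-identityʳₚ : ∀ p → p *ₚ 1ₚ ≈ₚ p
    *-identityʳₚ p = ≈-trans (*-commₚ p 1ₚ) (*-identityˡₚ p)

  polynomialRing : CommutativeRing c ℓ
  polynomialRing = record
    { Carrier = Poly
    ; _≈_ = _≈ₚ_
    ; _+_ = _+ₚ_
    ; _*_ = _*ₚ_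
    ; -_  = -ₚ_
    ; 0#  = 0ₚ
    ; 1#  = 1ₚ
    ; isCommutativeRing = record
      { isRing = record
        { +-isAbelianGroup = record
          { isGroup = record
            { isMonoid = record
              { isSemigroup = record
                { isMagma = record
                  { isEquivalence = record
                    { refl = ≈-refl ; sym = ≈-sym ; trans = ≈-trans }
                  ; ∙-cong = +-congₚ
                  }
                ; assoc = +-assocₚ
                }
              ; identity = (λ _ → ≈-refl) , +-identityʳₚ
              }
            ; inverse = neg-inverseˡ , neg-inverseʳ
            ; ⁻¹-cong = neg-cong
            }
          ; comm = +-commₚ
          }
        ; *-cong = *-congₚ
        ; *-assoc = *-assocₚ
        ; *-identity = *-identityˡₚ , *-identityʳₚ
        ; distrib = distribˡₚ , distribʳₚ
        }
      ; *-comm = *-commₚ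
      }
    }

ℤ[X] : CommutativeRing 0ℓ 0ℓ
ℤ[X] = Polynomial.polynomialRing ℤ.+-*-commutativeRing

ℤ[X,Y] : CommutativeRing 0ℓ 0ℓ
ℤ[X,Y] = Polynomial.polynomialRing ℤ[X]

X Y : CommutativeRing.Carrier ℤ[X,Y]
X = Polynomial.const ℤ[X] (Polynomial.var ℤ.+-*-commutativeRing)
Y = Polynomial.var ℤ[X]

subsets : ∀ n → List (Subset n)
subsets zero    = [] ∷ []
subsets (suc n) = map (outside ∷_) (subsets n) ++ map (inside ∷_) (subsets n)

-- The increasing enumeration of the elements of A.
element : ∀ {n} (A : Subset n) → Fin ∣ A ∣ → Fin n
element (true  ∷ A) zero    = zero
element (true  ∷ A) (suc i) = suc (element A i)
element (false ∷ A) i       = suc (element A i)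

𝔽₂ : CommutativeRing 0ℓ 0ℓ
𝔽₂ = Bool.xor-∧-commutativeRing

𝔽₂-sum : ∀ {n} → (Fin n → Bool) → Bool
𝔽₂-sum = RawMonoidOps.sum (CommutativeRing.+-rawMonoid 𝔽₂)

Matrix : ℕ → ℕ → Set
Matrix m n = Fin m → Fin n → Bool

-- The rows of M with index in S are linearly independent: any linear
-- combination (coefficients c, supported on S) that vanishes is trivial.
LinearlyIndependent : ∀ {m n} → Matrix m n → Subset m → Set
LinearlyIndependent {m} M S =
  (c : Vec Bool m) →
  (∀ i → i ∉ S → lookup c i ≡ false) →
  (∀ j → 𝔽₂-sum (λ i → lookup c i ∧ M i j) ≡ false) →
  ∀ i → lookup c i ≡ false

linearlyIndependent? : ∀ {m n} (M : Matrix m n) (S : Subset m) →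
                       Dec (LinearlyIndependent M S)
linearlyIndependent? {m} M S = decide (anySubset? (λ c → ¬? (trivial? c)))
  where
  Trivial : Vec Bool m → Set
  Trivial c = (∀ i → i ∉ S → lookup c i ≡ false) →
              (∀ j → 𝔽₂-sum (λ i → lookup c i ∧ M i j) ≡ false) →
              ∀ i → lookup c i ≡ false

  trivial? : ∀ c → Dec (Trivial c)
  trivial? c =
    Fin.all? (λ i → ¬? (i ∈? S) →-dec (lookup c i Bool.≟ false)) →-dec
    (Fin.all? (λ j → 𝔽₂-sum (λ i → lookup c i ∧ M i j) Bool.≟ false) →-dec
     Fin.all? (λ i → lookup c i Bool.≟ false))

  decide : Dec (∃ λ c → ¬ Trivial c) → Dec (∀ c → Trivial c)
  decide (yes (c , ¬p)) = no λ ind → ¬p (ind c)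
  decide (no ¬∃)        = yes λ c → decidable-stable (trivial? c) (λ ¬p → ¬∃ (c , ¬p))

-- The maximal number of linearly independent rows.
rank : ∀ {m n} → Matrix m n → ℕ
rank {m} M = max 0 (map ∣_∣ (filter (linearlyIndependent? M) (subsets m)))

-- Undirected, no multiple edges, loops allowed (adj i i ≡ true).
record Graph (n : ℕ) : Set where
  field
    adj     : Matrix n n
    adj-sym : ∀ i j → adj i j ≡ adj j i

open Graph public

_[_] : ∀ {n} → Graph n → (A : Subset n) → Graph ∣ A ∣
G [ A ] = record
  { adj     = λ i j → adj G (element A i) (element A j)
  ; adj-sym = λ i j → adj-sym G (element A i) (element A j)
  }

rk : ∀ {n} → Graph n → ℕ
rk G = rank (adj G)

-- G_k.  The vertex a_i is Fin.combine a i : Fin (n * k), so that quotient k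
-- sends a_i to a.  For a ≠ b, a_i ~ b_j iff {a,b} is an edge; for a = b,
-- a_i ~ a_j iff adj G a a, i.e. iff a has a loop.
clone : ∀ {n} (k : ℕ) → Graph n → Graph (n *ℕ k)
clone k G = record
  { adj     = λ v w → adj G (quotient k v) (quotient k w)
  ; adj-sym = λ v w → adj-sym G (quotient k v) (quotient k w)
  }

-- The two polynomials, at arguments in an arbitrary commutative ring; at the
-- indeterminates of ℤ[X,Y] they are the polynomials themselves.  The power
-- x ^ 0 is 1# for every x, including 0#.

module GraphPolynomials {c ℓ : Level} (R : CommutativeRing c ℓ) where

  open CommutativeRing R
  open SemiringExp semiring using (_^_)
  open RawMonoidOps +-rawMonoid using (sum)

  sumSubsets : ∀ n → (Subset n → Carrier) → Carrier
  sumSubsets n f = foldr _+_ 0# (map f (subsets n))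

  q : ∀ {n} → Graph n → Carrier → Carrier → Carrier
  q {n} G x y = sumSubsets n λ A →
    (x - 1#) ^ rk (G [ A ]) * (y - 1#) ^ (∣ A ∣ ∸ rk (G [ A ]))

  P : ∀ {n} → Graph n → Carrier → Carrier → Carrier
  P {n} G u x = sumSubsets n λ A → x ^ ∣ A ∣ * u ^ rk (G [ A ])

  -- 1 + y + … + y^(k-1), the meaning of (y^k - 1)/(y - 1).
  geometric : ℕ → Carrier → Carrier
  geometric k y = sum {k} (λ i → y ^ toℕ i)

{-# OPTIONS --safe #-}
module Submission where

-- Cloning vertices duplicates rows and columns of the adjacency matrix, so for
-- a set B of vertices of G_k the rank of G_k[B] is that of G[A], where A is the
-- set of vertices of G having a clone in B.  Summing s^(|B|-|A|) over all B
-- with given A factors over the vertices of A, each contributing the sum σ of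
-- s^(|C|-1) over the nonempty C ⊆ {1,…,k}, and σ = 1 + y + … + y^(k-1) with
-- y = 1 + s.  Both identities follow from sσ = y^k - 1; keeping the exponent
-- |B|-|A| avoids any division by s.

open import Defs
open import Algebra.Bundles using (CommutativeRing)
import Algebra.Properties.CommutativeMonoid.Sum as CommutativeMonoidSum
import Algebra.Properties.CommutativeSemigroup as CommutativeSemigroupProps
import Algebra.Properties.CommutativeSemiring.Exp as CommutativeSemiringExp
import Algebra.Properties.Monoid.Sum as MonoidSum
import Algebra.Properties.Ring as RingProps
import Algebra.Properties.Semiring.Exp as SemiringExp
open import Data.Bool.Base using (Bool; true; false; _∧_; _∨_; _xor_)
import Data.Bool.Properties as Bool
open import Data.Fin.Base using (Fin; zero; suc; toℕ; combine; quotient; remainder)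
open import Data.Fin.Properties using (_≟_; suc-injective; toℕ-fromℕ; toℕ-inject₁; combine-remQuot; remQuot-combine)
open import Data.Fin.Subset using (Subset; ∣_∣; _∈_; _∉_; ⊥)
open import Data.Fin.Subset.Properties using (_∈?_; ∉⊥; ∣⊥∣≡0; ∣p∣≤n)
open import Data.List.Base using (List; []; _∷_; map; foldr)
import Data.List.Base as List
open import Data.List.Extrema.Nat using (max≤v⁺; xs≤max)
import Data.List.Membership.Propositional as List
open import Data.List.Membership.Propositional.Properties using (∈-map⁺; ∈-map⁻; ∈-filter⁺; ∈-filter⁻; ∈-++⁺ˡ; ∈-++⁺ʳ)
open import Data.List.Properties using (map-++; map-∘)
import Data.List.Relation.Unary.All as All
open import Data.List.Relation.Unary.Any using (here)
open import Data.Nat.Base using (ℕ; zero; suc; _≤_; _∸_; z≤n; s≤s)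
import Data.Nat.Base as ℕ
import Data.Nat.Properties as ℕ
open import Data.Product.Base using (∃; _×_; _,_; proj₁; proj₂)
open import Data.Vec.Base using (Vec; []; _∷_; lookup; tabulate; _++_; splitAt; _[_]≔_; here; there)
import Data.Vec.Functional as Vector
open import Data.Vec.Functional.Properties using (updateAt-updates; updateAt-minimal)
open import Data.Vec.Properties using (lookup⇒[]=; []=⇒lookup; lookup∘tabulate; tabulate∘lookup; tabulate-cong; lookup-++ˡ; lookup-++ʳ; lookup∘update′)
open import Function.Base using (_∘_; const)
open import Function.Definitions using (Injective)
open import Level using (Level)
open import Relation.Binary.PropositionalEquality as ≡ using (_≡_; _≢_; cong; cong₂; subst)
open import Relation.Nullary.Decidable using (yes; no; does; dec-true; dec-false; decidable-stable)
open import Relation.Nullary.Negation using (¬_; contradiction)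

-- Ranks

module 𝔽₂-Sum = CommutativeMonoidSum (CommutativeRing.+-commutativeMonoid 𝔽₂)
open MonoidSum (CommutativeRing.+-monoid 𝔽₂) using (sum-cong-≗; sum-replicate-zero)

sum-indicator : ∀ {n} (i : Fin n) (h : Fin n → Bool) →
                𝔽₂-sum (λ l → does (i ≟ l) ∧ h l) ≡ h i
sum-indicator {suc n} zero h =
  ≡.trans (cong (h zero xor_) (sum-replicate-zero n)) (Bool.xor-identityʳ (h zero))
sum-indicator (suc i) h = sum-indicator i (h ∘ suc)

sum-updateAt : ∀ {n} (i : Fin n) (t : Fin n → Bool) →
               𝔽₂-sum t ≡ t i xor 𝔽₂-sum (Vector.updateAt t i (const false))
sum-updateAt zero    t = ≡.refl
sum-updateAt (suc i) t = ≡.trans (cong (t zero xor_) (sum-updateAt i (t ∘ suc)))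
  (x∙yz≈y∙xz (t zero) (t (suc i)) _)
  where open CommutativeSemigroupProps
          (CommutativeRing.+-commutativeSemigroup 𝔽₂) using (x∙yz≈y∙xz)

-- Independence of an indexed family of rows, with repetitions allowed a priori. In this form
-- independence moves along any reindexing of rows, with no subset to keep track of.
IndependentRows : ∀ {m n r} → Matrix m n → (Fin r → Fin m) → Set
IndependentRows {r = r} M f =
  (c : Fin r → Bool) →
  (∀ j → 𝔽₂-sum (λ i → c i ∧ M (f i) j) ≡ false) →
  ∀ i → c i ≡ false

-- A repeated row would give a vanishing sum of two rows.
independentRows-injective : ∀ {m n r} (M : Matrix m n) (f : Fin r → Fin m) →
  IndependentRows M f → ∀ {i j} → f i ≡ f j → i ≡ j
independentRows-injective M f ind {i} {j} fi≡fj = decidable-stable (i ≟ j) absurd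
  where
  c : _ → Bool
  c l = does (i ≟ l) xor does (j ≟ l)

  vanishes : ∀ k → 𝔽₂-sum (λ l → c l ∧ M (f l) k) ≡ false
  vanishes k = begin
    𝔽₂-sum (λ l → c l ∧ M (f l) k)
      ≡⟨ sum-cong-≗ (λ l → Bool.∧-distribʳ-xor (M (f l) k) (does (i ≟ l)) (does (j ≟ l))) ⟩
    𝔽₂-sum (λ l → (does (i ≟ l) ∧ M (f l) k) xor (does (j ≟ l) ∧ M (f l) k))
      ≡⟨ 𝔽₂-Sum.∑-distrib-+ (λ l → does (i ≟ l) ∧ M (f l) k) (λ l → does (j ≟ l) ∧ M (f l) k) ⟩
    𝔽₂-sum (λ l → does (i ≟ l) ∧ M (f l) k) xor 𝔽₂-sum (λ l → does (j ≟ l) ∧ M (f l) k)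
      ≡⟨ cong₂ _xor_ (sum-indicator i (λ l → M (f l) k)) (sum-indicator j (λ l → M (f l) k)) ⟩
    M (f i) k xor M (f j) k
      ≡⟨ cong (λ a → M (f i) k xor M a k) fi≡fj ⟨
    M (f i) k xor M (f i) k
      ≡⟨ Bool.xor-same (M (f i) k) ⟩
    false ∎
    where open ≡.≡-Reasoning

  absurd : ¬ (i ≢ j)
  absurd i≢j = contradiction (≡.trans (≡.sym c-i) (ind c vanishes i)) λ ()
    where
    c-i : c i ≡ true
    c-i = cong₂ _xor_ (dec-true (i ≟ i) ≡.refl) (dec-false (j ≟ i) (i≢j ∘ ≡.sym))

-- Independent subsets of rows versus independent families

scatter : ∀ {m} (S : Subset m) → (Fin ∣ S ∣ → Bool) → Vec Bool m
scatter []          c = []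
scatter (true  ∷ S) c = c zero ∷ scatter S (c ∘ suc)
scatter (false ∷ S) c = false ∷ scatter S c

lookup-scatter-element : ∀ {m} (S : Subset m) c i →
                         lookup (scatter S c) (element S i) ≡ c i
lookup-scatter-element (true  ∷ S) c zero    = ≡.refl
lookup-scatter-element (true  ∷ S) c (suc i) = lookup-scatter-element S (c ∘ suc) i
lookup-scatter-element (false ∷ S) c i       = lookup-scatter-element S c i

lookup-scatter-∉ : ∀ {m} (S : Subset m) c i → i ∉ S → lookup (scatter S c) i ≡ false
lookup-scatter-∉ (true  ∷ S) c zero    i∉S = contradiction here i∉S
lookup-scatter-∉ (true  ∷ S) c (suc i) i∉S = lookup-scatter-∉ S (c ∘ suc) i (i∉S ∘ there)
lookup-scatter-∉ (false ∷ S) c zero    i∉S = ≡.refl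
lookup-scatter-∉ (false ∷ S) c (suc i) i∉S = lookup-scatter-∉ S c i (i∉S ∘ there)

sum-scatter : ∀ {m} (S : Subset m) c (h : Fin m → Bool) →
  𝔽₂-sum (λ i → lookup (scatter S c) i ∧ h i) ≡ 𝔽₂-sum (λ i → c i ∧ h (element S i))
sum-scatter []          c h = ≡.refl
sum-scatter (true  ∷ S) c h = cong ((c zero ∧ h zero) xor_) (sum-scatter S (c ∘ suc) (h ∘ suc))
sum-scatter (false ∷ S) c h = sum-scatter S c (h ∘ suc)

-- `scatter` extends the coefficients by zero outside `S`; the extended combination is supported on
-- `S` and has the same column sums.
linearlyIndependent⇒independentRows : ∀ {m n} (M : Matrix m n) (S : Subset m) →
  LinearlyIndependent M S → IndependentRows M (element S)
linearlyIndependent⇒independentRows M S ind c vanishes i =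
  ≡.trans (≡.sym (lookup-scatter-element S c i))
    (ind (scatter S c) (lookup-scatter-∉ S c)
      (λ j → ≡.trans (sum-scatter S c (λ i → M i j)) (vanishes j)) (element S i))

∣insert∣ : ∀ {m} (S : Subset m) i → i ∉ S → ∣ S [ i ]≔ true ∣ ≡ suc ∣ S ∣
∣insert∣ (true  ∷ S) zero    i∉S = contradiction here i∉S
∣insert∣ (false ∷ S) zero    i∉S = ≡.refl
∣insert∣ (true  ∷ S) (suc i) i∉S = cong suc (∣insert∣ S i (i∉S ∘ there))
∣insert∣ (false ∷ S) (suc i) i∉S = ∣insert∣ S i (i∉S ∘ there)

∈-insert⁻ : ∀ {m} (S : Subset m) {i j} → j ≢ i → j ∈ S [ i ]≔ true → j ∈ S
∈-insert⁻ S {i} {j} j≢i j∈ = lookup⇒[]= j S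
  (≡.trans (≡.sym (lookup∘update′ j≢i S true)) ([]=⇒lookup j∈))

-- The image of `f` as a subset. The field `reindex` turns a sum supported on the image into a sum
-- along `f`, which is what transfers linear combinations.
record Range {m r} (f : Fin r → Fin m) : Set where
  field
    set         : Subset m
    cardinality : ∣ set ∣ ≡ r
    preimage    : ∀ {i} → i ∈ set → ∃ λ l → f l ≡ i
    reindex     : ∀ (t : Fin m → Bool) → (∀ i → i ∉ set → t i ≡ false) →
                  𝔽₂-sum t ≡ 𝔽₂-sum (t ∘ f)

-- Induction on `r`: by injectivity `f zero` is not among the later values, so inserting it raises
-- the cardinality by one and its summand splits off from the rest.
range : ∀ {m r} (f : Fin r → Fin m) → Injective _≡_ _≡_ f → Range f
range {m} {zero} f inj = record
  { set         = ⊥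
  ; cardinality = ∣⊥∣≡0 m
  ; preimage    = λ i∈⊥ → contradiction i∈⊥ ∉⊥
  ; reindex     = λ t t≡0 → ≡.trans (sum-cong-≗ (λ i → t≡0 i ∉⊥)) (sum-replicate-zero m)
  }
range {m} {suc r} f inj = record
  { set         = S [ f zero ]≔ true
  ; cardinality = ≡.trans (∣insert∣ S (f zero) f0∉S) (cong suc cardinality)
  ; preimage    = preimage′
  ; reindex     = reindex′
  }
  where
  open Range (range (f ∘ suc) (λ e → suc-injective (inj e))) renaming (set to S)

  f0∉S : f zero ∉ S
  f0∉S f0∈S with preimage f0∈S
  ... | l , e = contradiction (inj e) λ ()

  preimage′ : ∀ {i} → i ∈ S [ f zero ]≔ true → ∃ λ l → f l ≡ i
  preimage′ {i} i∈ with i ≟ f zero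
  ... | yes i≡f0 = zero , ≡.sym i≡f0
  ... | no  i≢f0 with l , e ← preimage (∈-insert⁻ S i≢f0 i∈) = suc l , e

  reindex′ : ∀ t → (∀ i → i ∉ S [ f zero ]≔ true → t i ≡ false) →
             𝔽₂-sum t ≡ 𝔽₂-sum (t ∘ f)
  reindex′ t t≡0 = begin
    𝔽₂-sum t                               ≡⟨ sum-updateAt (f zero) t ⟩
    t (f zero) xor 𝔽₂-sum t′               ≡⟨ cong (t (f zero) xor_) (reindex t′ t′≡0) ⟩
    t (f zero) xor 𝔽₂-sum (t′ ∘ f ∘ suc)   ≡⟨ cong (t (f zero) xor_) (sum-cong-≗ t′≡t) ⟩
    t (f zero) xor 𝔽₂-sum (t ∘ f ∘ suc)    ∎
    where
    open ≡.≡-Reasoning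
    -- Clearing the entry at `f zero` makes the function vanish off `S`, as the induction hypothesis
    -- requires.
    t′ : Fin m → Bool
    t′ = Vector.updateAt t (f zero) (const false)

    t′≡0 : ∀ i → i ∉ S → t′ i ≡ false
    t′≡0 i i∉S with i ≟ f zero
    ... | yes ≡.refl = updateAt-updates (f zero) t
    ... | no  i≢f0   = ≡.trans (updateAt-minimal i (f zero) t i≢f0)
                               (t≡0 i (i∉S ∘ ∈-insert⁻ S i≢f0))

    -- By injectivity the cleared entry is never met along `f ∘ suc`.
    t′≡t : ∀ l → t′ (f (suc l)) ≡ t (f (suc l))
    t′≡t l = updateAt-minimal _ _ t λ e → contradiction (inj e) λ ()

-- An independent family has no repeated rows, so its range has exactly `r` elements, and a
-- vanishing combination supported on the range pulls back to one along `f`.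
independentRows⇒linearlyIndependent : ∀ {m n r} (M : Matrix m n) (f : Fin r → Fin m) →
  IndependentRows M f → ∃ λ S → ∣ S ∣ ≡ r × LinearlyIndependent M S
independentRows⇒linearlyIndependent M f ind = set , cardinality , independent
  where
  open Range (range f (independentRows-injective M f ind))

  independent : LinearlyIndependent M set
  independent c supp vanishes i with i ∈? set
  ... | no  i∉S = supp i i∉S
  ... | yes i∈S with l , ≡.refl ← preimage i∈S =
    ind (lookup c ∘ f)
      (λ j → ≡.trans
        (≡.sym (reindex (λ i → lookup c i ∧ M i j) (λ i i∉S → cong (_∧ M i j) (supp i i∉S))))
        (vanishes j))
      l

-- Rank as a maximum, and its behaviour under reindexing

∈-subsets : ∀ {n} (A : Subset n) → A List.∈ subsets n
∈-subsets []          = here ≡.refl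
∈-subsets (false ∷ A) = ∈-++⁺ˡ (∈-map⁺ (false ∷_) (∈-subsets A))
∈-subsets (true  ∷ A) = ∈-++⁺ʳ _ (∈-map⁺ (true ∷_) (∈-subsets A))

∣independent∣≤rank : ∀ {m n} (M : Matrix m n) {S} → LinearlyIndependent M S → ∣ S ∣ ≤ rank M
∣independent∣≤rank M {S} ind = All.lookup (xs≤max 0 _)
  (∈-map⁺ ∣_∣ (∈-filter⁺ (linearlyIndependent? M) (∈-subsets S) ind))

rank-least : ∀ {m n} (M : Matrix m n) {b} →
             (∀ S → LinearlyIndependent M S → ∣ S ∣ ≤ b) → rank M ≤ b
-- `z≤n` handles the default value 0 from which `max` starts.
rank-least {m} M {b} bound = max≤v⁺ z≤n (All.tabulate bounded)
  where
  bounded : ∀ {s} → s List.∈ map ∣_∣ (List.filter (linearlyIndependent? M) (subsets m)) → s ≤ b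
  bounded s∈ with S , S∈ , ≡.refl ← ∈-map⁻ ∣_∣ s∈ =
    bound S (proj₂ (∈-filter⁻ (linearlyIndependent? M) {xs = subsets m} S∈))

rank≤rows : ∀ {m n} (M : Matrix m n) → rank M ≤ m
rank≤rows M = rank-least M λ S _ → ∣p∣≤n S

-- No injectivity of ρ is assumed: it maps independent rows of M to independent,
-- hence distinct, rows of M′.
rank-reindex-≤ : ∀ {m n m′ n′} (M : Matrix m n) (M′ : Matrix m′ n′)
  (ρ : Fin m → Fin m′) (γ : Fin n → Fin n′) →
  (∀ i j → M i j ≡ M′ (ρ i) (γ j)) → rank M ≤ rank M′
rank-reindex-≤ M M′ ρ γ M≡M′ = rank-least M bound
  where
  bound : ∀ S → LinearlyIndependent M S → ∣ S ∣ ≤ rank M′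
  -- A combination of rows of `M′` that vanishes in every column vanishes in particular in the
  -- columns `γ j`, where it is a combination of rows of `M`.
  bound S ind with T , ∣T∣≡∣S∣ , indT ← independentRows⇒linearlyIndependent M′ (ρ ∘ element S)
    (λ c vanishes → linearlyIndependent⇒independentRows M S ind c λ j →
      ≡.trans (sum-cong-≗ (λ i → cong (c i ∧_) (M≡M′ (element S i) j))) (vanishes (γ j)))
    = subst (_≤ rank M′) ∣T∣≡∣S∣ (∣independent∣≤rank M′ indT)

-- The set of vertices having a clone in B

-- Boolean-valued, so that it can serve directly as an entry of the characteristic vector `support`.
inhabited : ∀ {n} → Subset n → Bool
inhabited []      = false
inhabited (b ∷ C) = b ∨ inhabited C

support : ∀ n k → Subset (n ℕ.* k) → Subset n
support n k B = tabulate λ a → inhabited {k} (tabulate λ j → lookup B (combine a j))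

element-∈ : ∀ {n} (A : Subset n) i → element A i ∈ A
element-∈ (true  ∷ A) zero    = here
element-∈ (true  ∷ A) (suc i) = there (element-∈ A i)
element-∈ (false ∷ A) i       = there (element-∈ A i)

∈⇒element : ∀ {n} (A : Subset n) {x} → x ∈ A → ∃ λ i → element A i ≡ x
∈⇒element (true  ∷ A) here       = zero , ≡.refl
∈⇒element (true  ∷ A) (there x∈) with i , e ← ∈⇒element A x∈ = suc i , cong suc e
∈⇒element (false ∷ A) (there x∈) with i , e ← ∈⇒element A x∈ = i , cong suc e

∈⇒inhabited : ∀ {n} (C : Subset n) {x} → x ∈ C → inhabited C ≡ true
∈⇒inhabited (true  ∷ C) x∈         = ≡.refl
∈⇒inhabited (false ∷ C) (there x∈) = ∈⇒inhabited C x∈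

inhabited⇒∈ : ∀ {n} (C : Subset n) → inhabited C ≡ true → ∃ λ x → x ∈ C
inhabited⇒∈ (true  ∷ C) e = zero , here
inhabited⇒∈ (false ∷ C) e with x , x∈ ← inhabited⇒∈ C e = suc x , there x∈

module _ {n} (k : ℕ) (B : Subset (n ℕ.* k)) where

  private
    fibre : Fin n → Subset k
    fibre a = tabulate λ j → lookup B (combine a j)

  ∈⇒quotient∈support : ∀ {v} → v ∈ B → quotient k v ∈ support n k B
  ∈⇒quotient∈support {v} v∈B = lookup⇒[]= a _ (≡.trans
    (lookup∘tabulate (inhabited ∘ fibre) a)
    (∈⇒inhabited (fibre a) {j} (lookup⇒[]= j _ (≡.trans
      (lookup∘tabulate _ j)
      (≡.trans (cong (lookup B) (combine-remQuot {n} k v)) ([]=⇒lookup v∈B))))))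
    where
    a : Fin n
    a = quotient k v
    j : Fin k
    j = remainder {n} k v

  ∈support⇒clone∈ : ∀ {a} → a ∈ support n k B → ∃ λ v → v ∈ B × quotient k v ≡ a
  ∈support⇒clone∈ {a} a∈ with j , j∈ ← inhabited⇒∈ (fibre a)
      (≡.trans (≡.sym (lookup∘tabulate (inhabited ∘ fibre) a)) ([]=⇒lookup a∈)) =
    combine a j ,
    lookup⇒[]= _ B (≡.trans (≡.sym (lookup∘tabulate _ j)) ([]=⇒lookup j∈)) ,
    cong proj₁ (remQuot-combine a j)

  -- Adjacency in the clone depends only on quotients, so each of the two matrices is a reindexing
  -- of the other: `down` sends a vertex of `B` to its original, and `up` picks for each vertex of
  -- the support one of its clones in `B`. Each direction gives one inequality of ranks.
  rk-clone : (G : Graph n) → rk (clone k G [ B ]) ≡ rk (G [ support n k B ])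
  rk-clone G = ℕ.≤-antisym
    (rank-reindex-≤ _ _ (proj₁ ∘ down) (proj₁ ∘ down)
      λ i j → cong₂ (adj G) (≡.sym (proj₂ (down i))) (≡.sym (proj₂ (down j))))
    (rank-reindex-≤ _ _ (proj₁ ∘ up) (proj₁ ∘ up)
      λ i j → cong₂ (adj G) (≡.sym (proj₂ (up i))) (≡.sym (proj₂ (up j))))
    where
    down : ∀ i → ∃ λ i′ → element (support n k B) i′ ≡ quotient k (element B i)
    down i = ∈⇒element (support n k B) (∈⇒quotient∈support (element-∈ B i))

    up : ∀ i → ∃ λ i′ → quotient k (element B i′) ≡ element (support n k B) i
    up i with v , v∈B , e ← ∈support⇒clone∈ (element-∈ (support n k B) i)
         with i′ , e′ ← ∈⇒element B v∈B = i′ , ≡.trans (cong (quotient k) e′) e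

-- Splitting off the clones of one vertex

-- `combine` lists the clones of vertex `zero` first: `C` is the fibre over that vertex, and `D`
-- contains the chosen clones of all others.
support-++ : ∀ n k (C : Subset k) (D : Subset (n ℕ.* k)) →
             support (suc n) k (C ++ D) ≡ inhabited C ∷ support n k D
support-++ n k C D = cong₂ _∷_
  (cong inhabited (≡.trans (tabulate-cong (lookup-++ˡ C D)) (tabulate∘lookup C)))
  (tabulate-cong λ a → cong inhabited (tabulate-cong λ j → lookup-++ʳ C D (combine a j)))

∣++∣ : ∀ {m n} (C : Subset m) (D : Subset n) → ∣ C ++ D ∣ ≡ ∣ C ∣ ℕ.+ ∣ D ∣
∣++∣ []          D = ≡.refl
∣++∣ (true  ∷ C) D = cong suc (∣++∣ C D)
∣++∣ (false ∷ C) D = ∣++∣ C D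

-- The left side is 1 or 0, the contribution of a single vertex to the size of the support. Written
-- as the size of a one-entry subset, it fits `∣++∣`.
∣inhabited∣≤ : ∀ {n} (C : Subset n) → ∣ inhabited C ∷ [] ∣ ≤ ∣ C ∣
∣inhabited∣≤ []          = z≤n
∣inhabited∣≤ (true  ∷ C) = s≤s z≤n
∣inhabited∣≤ (false ∷ C) = ∣inhabited∣≤ C

∣support∣≤ : ∀ n k (B : Subset (n ℕ.* k)) → ∣ support n k B ∣ ≤ ∣ B ∣
∣support∣≤ zero    k B = z≤n
∣support∣≤ (suc n) k B with C , D , ≡.refl ← splitAt k B = begin
  ∣ support (suc n) k (C ++ D) ∣                  ≡⟨ cong ∣_∣ (support-++ n k C D) ⟩
  ∣ (inhabited C ∷ []) ++ support n k D ∣         ≡⟨ ∣++∣ (inhabited C ∷ []) (support n k D) ⟩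
  ∣ inhabited C ∷ [] ∣ ℕ.+ ∣ support n k D ∣      ≤⟨ ℕ.+-mono-≤ (∣inhabited∣≤ C) (∣support∣≤ n k D) ⟩
  ∣ C ∣ ℕ.+ ∣ D ∣                                 ≡⟨ ∣++∣ C D ⟨
  ∣ C ++ D ∣                                      ∎
  where open ℕ.≤-Reasoning

∸-+-interchange : ∀ {a b c d} → b ≤ a → d ≤ c →
                  (a ℕ.+ c) ∸ (b ℕ.+ d) ≡ (a ∸ b) ℕ.+ (c ∸ d)
∸-+-interchange {a} {b} {c} {d} b≤a d≤c = begin
  (a ℕ.+ c) ∸ (b ℕ.+ d)  ≡⟨ ℕ.∸-+-assoc (a ℕ.+ c) b d ⟨
  (a ℕ.+ c) ∸ b ∸ d      ≡⟨ cong (_∸ d) (ℕ.+-∸-comm c b≤a) ⟩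
  (a ∸ b) ℕ.+ c ∸ d      ≡⟨ ℕ.+-∸-assoc (a ∸ b) d≤c ⟩
  (a ∸ b) ℕ.+ (c ∸ d)    ∎
  where open ≡.≡-Reasoning

∸-telescope : ∀ {a b c} → c ≤ b → b ≤ a → a ∸ c ≡ (a ∸ b) ℕ.+ (b ∸ c)
∸-telescope {a} {b} {c} c≤b b≤a =
  ≡.trans (cong (_∸ c) (≡.sym (ℕ.m∸n+n≡m b≤a))) (ℕ.+-∸-assoc (a ∸ b) c≤b)

-- The exponent of `s` is additive over the vertices of `G`. Truncated subtraction does no harm,
-- because neither subtrahend exceeds its minuend.
excess-++ : ∀ n k (C : Subset k) (D : Subset (n ℕ.* k)) →
  ∣ C ++ D ∣ ∸ ∣ support (suc n) k (C ++ D) ∣ ≡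
  (∣ C ∣ ∸ ∣ inhabited C ∷ [] ∣) ℕ.+ (∣ D ∣ ∸ ∣ support n k D ∣)
excess-++ n k C D = ≡.trans
  (cong₂ _∸_ (∣++∣ C D)
    (≡.trans (cong ∣_∣ (support-++ n k C D)) (∣++∣ (inhabited C ∷ []) (support n k D))))
  (∸-+-interchange (∣inhabited∣≤ C) (∣support∣≤ n k D))

-- Sums over subsets

module CloneSums {c ℓ : Level} (R : CommutativeRing c ℓ) where

  open CommutativeRing R
  open SemiringExp semiring using (_^_; ^-cong; ^-congˡ; ^-congʳ; ^-homo-*)
  open CommutativeSemiringExp commutativeSemiring using (^-distrib-*)
  open CommutativeSemigroupProps *-commutativeSemigroup using (interchange; x∙yz≈y∙xz)
  open RingProps ring using (//-rightDividesʳ; //-rightDividesˡ)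
  open MonoidSum +-monoid using (sum-init-last; sum-cong-≋)
  open GraphPolynomials R
  open import Relation.Binary.Reasoning.Setoid setoid

  sumList : List Carrier → Carrier
  sumList = foldr _+_ 0#

  sumList-++ : ∀ xs ys → sumList (xs List.++ ys) ≈ sumList xs + sumList ys
  sumList-++ []       ys = sym (+-identityˡ _)
  sumList-++ (x ∷ xs) ys = trans (+-congˡ (sumList-++ xs ys)) (sym (+-assoc x _ _))

  sumSubsets-cong : ∀ n {f g : Subset n → Carrier} → (∀ A → f A ≈ g A) →
                    sumSubsets n f ≈ sumSubsets n g
  sumSubsets-cong n {f} {g} f≈g = go (subsets n)
    where
    go : ∀ xs → sumList (map f xs) ≈ sumList (map g xs)
    go []       = refl
    go (x ∷ xs) = +-cong (f≈g x) (go xs)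

  *-distribˡ-sumSubsets : ∀ n a (f : Subset n → Carrier) →
                          sumSubsets n (λ A → a * f A) ≈ a * sumSubsets n f
  *-distribˡ-sumSubsets n a f = go (subsets n)
    where
    go : ∀ xs → sumList (map (λ A → a * f A) xs) ≈ a * sumList (map f xs)
    go []       = sym (zeroʳ a)
    go (x ∷ xs) = trans (+-congˡ (go xs)) (sym (distribˡ a _ _))

  sumSubsets-suc : ∀ n (f : Subset (suc n) → Carrier) →
    sumSubsets (suc n) f ≈ sumSubsets n (f ∘ (false ∷_)) + sumSubsets n (f ∘ (true ∷_))
  sumSubsets-suc n f = begin
    sumList (map f (map (false ∷_) (subsets n) List.++ map (true ∷_) (subsets n)))
      ≡⟨ cong sumList (map-++ f (map (false ∷_) (subsets n)) _) ⟩
    sumList (map f (map (false ∷_) (subsets n)) List.++ map f (map (true ∷_) (subsets n)))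
      ≈⟨ sumList-++ (map f (map (false ∷_) (subsets n))) _ ⟩
    sumList (map f (map (false ∷_) (subsets n))) + sumList (map f (map (true ∷_) (subsets n)))
      ≡⟨ cong₂ (λ xs ys → sumList xs + sumList ys) (map-∘ (subsets n)) (map-∘ (subsets n)) ⟨
    sumSubsets n (f ∘ (false ∷_)) + sumSubsets n (f ∘ (true ∷_)) ∎

  sumSubsets-++ : ∀ m n (f : Subset (m ℕ.+ n) → Carrier) →
    sumSubsets (m ℕ.+ n) f ≈ sumSubsets m (λ C → sumSubsets n (λ D → f (C ++ D)))
  sumSubsets-++ zero    n f = sym (+-identityʳ _)
  sumSubsets-++ (suc m) n f = begin
    sumSubsets (suc m ℕ.+ n) f
      ≈⟨ sumSubsets-suc (m ℕ.+ n) f ⟩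
    sumSubsets (m ℕ.+ n) (f ∘ (false ∷_)) + sumSubsets (m ℕ.+ n) (f ∘ (true ∷_))
      ≈⟨ +-cong (sumSubsets-++ m n (f ∘ (false ∷_))) (sumSubsets-++ m n (f ∘ (true ∷_))) ⟩
    sumSubsets m (λ C → sumSubsets n (λ D → f (false ∷ C ++ D))) +
    sumSubsets m (λ C → sumSubsets n (λ D → f (true ∷ C ++ D)))
      ≈⟨ sumSubsets-suc m (λ C → sumSubsets n (λ D → f (C ++ D))) ⟨
    sumSubsets (suc m) (λ C → sumSubsets n (λ D → f (C ++ D))) ∎

  -- The binomial theorem: each element contributes a factor 1 if left out and `s` if taken.
  sumSubsets-^∣∣ : ∀ n s → sumSubsets n (λ A → s ^ ∣ A ∣) ≈ (1# + s) ^ n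
  sumSubsets-^∣∣ zero    s = +-identityʳ 1#
  sumSubsets-^∣∣ (suc n) s = begin
    sumSubsets (suc n) (λ A → s ^ ∣ A ∣)
      ≈⟨ sumSubsets-suc n (λ A → s ^ ∣ A ∣) ⟩
    sumSubsets n (λ A → s ^ ∣ A ∣) + sumSubsets n (λ A → s * s ^ ∣ A ∣)
      ≈⟨ +-cong (sym (*-identityˡ _)) (*-distribˡ-sumSubsets n s (λ A → s ^ ∣ A ∣)) ⟩
    1# * sumSubsets n (λ A → s ^ ∣ A ∣) + s * sumSubsets n (λ A → s ^ ∣ A ∣)
      ≈⟨ distribʳ _ 1# s ⟨
    (1# + s) * sumSubsets n (λ A → s ^ ∣ A ∣)
      ≈⟨ *-congˡ (sumSubsets-^∣∣ n s) ⟩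
    (1# + s) ^ suc n ∎

  -- Geometric sums and the contribution of one fibre

  -- The definition unfolds at the constant term, whereas the inductions on `k` add the top power.
  geometric-suc : ∀ k y → geometric (suc k) y ≈ geometric k y + y ^ k
  geometric-suc k y = trans (sum-init-last {k} (λ i → y ^ toℕ i))
    (+-cong (sum-cong-≋ {k} (λ i → ^-congʳ y (toℕ-inject₁ i))) (^-congʳ y (toℕ-fromℕ k)))

  geometric-cong : ∀ k {y z} → y ≈ z → geometric k y ≈ geometric k z
  geometric-cong k y≈z = sum-cong-≋ {k} (λ i → ^-congˡ (toℕ i) y≈z)

  geometric-closed : ∀ k s → geometric k (1# + s) * s ≈ (1# + s) ^ k - 1#
  geometric-closed k s = begin
    geometric k (1# + s) * s               ≈⟨ //-rightDividesʳ 1# _ ⟨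
    geometric k (1# + s) * s + 1# - 1#     ≈⟨ +-congʳ (telescope k) ⟩
    (1# + s) ^ k - 1#                      ∎
    where
    -- The form without subtraction, suited to induction; the 1 is cancelled afterwards.
    telescope : ∀ k → geometric k (1# + s) * s + 1# ≈ (1# + s) ^ k
    telescope zero    = trans (+-congʳ (zeroˡ s)) (+-identityˡ 1#)
    telescope (suc k) = begin
      geometric (suc k) (1# + s) * s + 1#
        ≈⟨ +-congʳ (*-congʳ (geometric-suc k (1# + s))) ⟩
      (geometric k (1# + s) + (1# + s) ^ k) * s + 1#
        ≈⟨ +-congʳ (trans (distribʳ s _ _) (+-comm _ _)) ⟩
      (1# + s) ^ k * s + geometric k (1# + s) * s + 1#
        ≈⟨ +-assoc _ _ _ ⟩
      (1# + s) ^ k * s + (geometric k (1# + s) * s + 1#)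
        ≈⟨ +-cong (*-comm _ s) (trans (telescope k) (sym (*-identityˡ _))) ⟩
      s * (1# + s) ^ k + 1# * (1# + s) ^ k
        ≈⟨ trans (+-comm _ _) (sym (distribʳ _ 1# s)) ⟩
      (1# + s) ^ suc k ∎

  -- The empty set yields `h false`. In the induction, subsets omitting the first clone give the sum
  -- for `k`; those containing it are nonempty with excess equal to the size of the remainder, so by
  -- the binomial theorem they add the next term `(1# + s) ^ k` of the geometric sum.
  sumSubsets-inhabited : ∀ k s (h : Bool → Carrier) →
    sumSubsets k (λ C → s ^ (∣ C ∣ ∸ ∣ inhabited C ∷ [] ∣) * h (inhabited C)) ≈
    h false + geometric k (1# + s) * h true
  sumSubsets-inhabited zero    s h =
    +-cong (*-identityˡ _) (sym (zeroˡ _))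
  sumSubsets-inhabited (suc k) s h = begin
    sumSubsets (suc k) F
      ≈⟨ sumSubsets-suc k F ⟩
    sumSubsets k F + sumSubsets k (λ C → s ^ ∣ C ∣ * h true)
      ≈⟨ +-cong (sumSubsets-inhabited k s h) (trans
           (sumSubsets-cong k (λ C → *-comm (s ^ ∣ C ∣) (h true)))
           (trans (*-distribˡ-sumSubsets k (h true) (λ C → s ^ ∣ C ∣)) (*-comm _ _))) ⟩
    h false + geometric k (1# + s) * h true + sumSubsets k (λ C → s ^ ∣ C ∣) * h true
      ≈⟨ +-assoc _ _ _ ⟩
    h false + (geometric k (1# + s) * h true + sumSubsets k (λ C → s ^ ∣ C ∣) * h true)
      ≈⟨ +-congˡ (distribʳ (h true) _ _) ⟨
    h false + (geometric k (1# + s) + sumSubsets k (λ C → s ^ ∣ C ∣)) * h true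
      ≈⟨ +-congˡ (*-congʳ (+-congˡ (sumSubsets-^∣∣ k s))) ⟩
    h false + (geometric k (1# + s) + (1# + s) ^ k) * h true
      ≈⟨ +-congˡ (*-congʳ (geometric-suc k (1# + s))) ⟨
    h false + geometric (suc k) (1# + s) * h true ∎
    where
    F : ∀ {k} → Subset k → Carrier
    F C = s ^ (∣ C ∣ ∸ ∣ inhabited C ∷ [] ∣) * h (inhabited C)

  -- Induction on the vertices of `G`. The weight `g` is arbitrary so that the hypothesis applies to
  -- the remaining vertices once membership of the first one in the support is fixed.
  sumSubsets-support : ∀ n k s (g : Subset n → Carrier) →
    sumSubsets (n ℕ.* k) (λ B → s ^ (∣ B ∣ ∸ ∣ support n k B ∣) * g (support n k B)) ≈
    sumSubsets n (λ A → geometric k (1# + s) ^ ∣ A ∣ * g A)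
  sumSubsets-support zero    k s g = refl
  sumSubsets-support (suc n) k s g = begin
    sumSubsets (k ℕ.+ n ℕ.* k) F
      ≈⟨ sumSubsets-++ k (n ℕ.* k) F ⟩
    sumSubsets k (λ C → sumSubsets (n ℕ.* k) (λ D → F (C ++ D)))
      ≈⟨ sumSubsets-cong k inner ⟩
    sumSubsets k (λ C → s ^ (∣ C ∣ ∸ ∣ inhabited C ∷ [] ∣) * H (inhabited C))
      ≈⟨ sumSubsets-inhabited k s H ⟩
    H false + σ * H true
      ≈⟨ +-congˡ (*-distribˡ-sumSubsets n σ (λ A → σ ^ ∣ A ∣ * g (true ∷ A))) ⟨
    H false + sumSubsets n (λ A → σ * (σ ^ ∣ A ∣ * g (true ∷ A)))
      ≈⟨ +-congˡ (sumSubsets-cong n (λ A → *-assoc σ (σ ^ ∣ A ∣) (g (true ∷ A)))) ⟨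
    H false + sumSubsets n (λ A → σ ^ suc ∣ A ∣ * g (true ∷ A))
      ≈⟨ sumSubsets-suc n (λ A → σ ^ ∣ A ∣ * g A) ⟨
    sumSubsets (suc n) (λ A → σ ^ ∣ A ∣ * g A) ∎
    where
    σ : Carrier
    σ = geometric k (1# + s)

    F : Subset (suc n ℕ.* k) → Carrier
    F B = s ^ (∣ B ∣ ∸ ∣ support (suc n) k B ∣) * g (support (suc n) k B)

    -- The sum over the remaining vertices, which depends on the first fibre only through whether it
    -- is empty.
    H : Bool → Carrier
    H b = sumSubsets n (λ A → σ ^ ∣ A ∣ * g (b ∷ A))

    inner : ∀ C → sumSubsets (n ℕ.* k) (λ D → F (C ++ D)) ≈
                  s ^ (∣ C ∣ ∸ ∣ inhabited C ∷ [] ∣) * H (inhabited C)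
    inner C = begin
      sumSubsets (n ℕ.* k) (λ D → F (C ++ D))
        ≈⟨ sumSubsets-cong (n ℕ.* k) split ⟩
      sumSubsets (n ℕ.* k) (λ D → s ^ e * F′ D)
        ≈⟨ *-distribˡ-sumSubsets (n ℕ.* k) (s ^ e) F′ ⟩
      s ^ e * sumSubsets (n ℕ.* k) F′
        ≈⟨ *-congˡ (sumSubsets-support n k s (g ∘ (inhabited C ∷_))) ⟩
      s ^ e * H (inhabited C) ∎
      where
      e : ℕ
      e = ∣ C ∣ ∸ ∣ inhabited C ∷ [] ∣

      F′ : Subset (n ℕ.* k) → Carrier
      F′ D = s ^ (∣ D ∣ ∸ ∣ support n k D ∣) * g (inhabited C ∷ support n k D)

      split : ∀ D → F (C ++ D) ≈ s ^ e * F′ D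
      split D = begin
        F (C ++ D)
          ≡⟨ cong₂ (λ i A → s ^ i * g A) (excess-++ n k C D) (support-++ n k C D) ⟩
        s ^ (e ℕ.+ (∣ D ∣ ∸ ∣ support n k D ∣)) * g (inhabited C ∷ support n k D)
          ≈⟨ *-congʳ (^-homo-* s e _) ⟩
        s ^ e * s ^ (∣ D ∣ ∸ ∣ support n k D ∣) * g (inhabited C ∷ support n k D)
          ≈⟨ *-assoc _ _ _ ⟩
        s ^ e * F′ D ∎

  -- The two identities over a commutative ring

  -- With `A` the support of `B`, `x ^ ∣ B ∣` splits into the excess power and `x ^ ∣ A ∣`. After
  -- summation each vertex of `A` carries `σ * x`, which is `(1# + x) ^ k - 1#`.
  P-clone : ∀ {n} (G : Graph n) k u x → P (clone k G) u x ≈ P G u ((1# + x) ^ k - 1#)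
  P-clone {n} G k u x = begin
    P (clone k G) u x
      ≈⟨ sumSubsets-cong (n ℕ.* k) regroup ⟩
    sumSubsets (n ℕ.* k) (λ B → x ^ (∣ B ∣ ∸ ∣ support n k B ∣) * g (support n k B))
      ≈⟨ sumSubsets-support n k x g ⟩
    sumSubsets n (λ A → σ ^ ∣ A ∣ * g A)
      ≈⟨ sumSubsets-cong n collect ⟩
    P G u ((1# + x) ^ k - 1#) ∎
    where
    σ : Carrier
    σ = geometric k (1# + x)

    g : Subset n → Carrier
    g A = x ^ ∣ A ∣ * u ^ rk (G [ A ])

    regroup : ∀ B → x ^ ∣ B ∣ * u ^ rk (clone k G [ B ]) ≈
                    x ^ (∣ B ∣ ∸ ∣ support n k B ∣) * g (support n k B)
    regroup B = begin
      x ^ ∣ B ∣ * u ^ rk (clone k G [ B ])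
        ≡⟨ cong₂ (λ i r → x ^ i * u ^ r)
             (≡.sym (ℕ.m∸n+n≡m (∣support∣≤ n k B))) (rk-clone k B G) ⟩
      x ^ (∣ B ∣ ∸ ∣ support n k B ∣ ℕ.+ ∣ support n k B ∣) * u ^ rk (G [ support n k B ])
        ≈⟨ *-congʳ (^-homo-* x (∣ B ∣ ∸ ∣ support n k B ∣) _) ⟩
      x ^ (∣ B ∣ ∸ ∣ support n k B ∣) * x ^ ∣ support n k B ∣ * u ^ rk (G [ support n k B ])
        ≈⟨ *-assoc _ _ _ ⟩
      x ^ (∣ B ∣ ∸ ∣ support n k B ∣) * g (support n k B) ∎

    collect : ∀ A → σ ^ ∣ A ∣ * g A ≈ ((1# + x) ^ k - 1#) ^ ∣ A ∣ * u ^ rk (G [ A ])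
    collect A = begin
      σ ^ ∣ A ∣ * (x ^ ∣ A ∣ * u ^ rk (G [ A ]))   ≈⟨ *-assoc _ _ _ ⟨
      σ ^ ∣ A ∣ * x ^ ∣ A ∣ * u ^ rk (G [ A ])     ≈⟨ *-congʳ (^-distrib-* σ x ∣ A ∣) ⟨
      (σ * x) ^ ∣ A ∣ * u ^ rk (G [ A ])
        ≈⟨ *-congʳ (^-congˡ ∣ A ∣ (geometric-closed k x)) ⟩
      ((1# + x) ^ k - 1#) ^ ∣ A ∣ * u ^ rk (G [ A ]) ∎

  -- Cloning keeps the rank, so all the excess goes into the nullity exponent, the one on `s`. The
  -- resulting factor `σ` per vertex of `A` is shared out: `r A` copies join `t`, and the other
  -- `∣ A ∣ ∸ r A` join `s`.
  q-clone : ∀ {n} (G : Graph n) k x y →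
            q (clone k G) x y ≈ q G ((x - 1#) * geometric k y + 1#) (y ^ k)
  q-clone {n} G k x y = begin
    q (clone k G) x y
      ≈⟨ sumSubsets-cong (n ℕ.* k) regroup ⟩
    sumSubsets (n ℕ.* k) (λ B → s ^ (∣ B ∣ ∸ ∣ support n k B ∣) * g (support n k B))
      ≈⟨ sumSubsets-support n k s g ⟩
    sumSubsets n (λ A → geometric k (1# + s) ^ ∣ A ∣ * g A)
      ≈⟨ sumSubsets-cong n collect ⟩
    q G ((x - 1#) * geometric k y + 1#) (y ^ k) ∎
    where
    s t σ : Carrier
    s = y - 1#
    t = x - 1#
    σ = geometric k y

    1+s≈y : 1# + s ≈ y
    1+s≈y = trans (+-comm 1# s) (//-rightDividesˡ 1# y)

    σ*s≈y^k-1 : σ * s ≈ y ^ k - 1#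
    σ*s≈y^k-1 = begin
      σ * s                       ≈⟨ *-congʳ (geometric-cong k 1+s≈y) ⟨
      geometric k (1# + s) * s    ≈⟨ geometric-closed k s ⟩
      (1# + s) ^ k - 1#           ≈⟨ +-congʳ (^-congˡ k 1+s≈y) ⟩
      y ^ k - 1#                  ∎

    r : Subset n → ℕ
    r A = rk (G [ A ])

    r≤ : ∀ A → r A ≤ ∣ A ∣
    r≤ A = rank≤rows (adj (G [ A ]))

    g : Subset n → Carrier
    g A = t ^ r A * s ^ (∣ A ∣ ∸ r A)

    regroup : ∀ B → t ^ rk (clone k G [ B ]) * s ^ (∣ B ∣ ∸ rk (clone k G [ B ])) ≈
                    s ^ (∣ B ∣ ∸ ∣ support n k B ∣) * g (support n k B)
    regroup B = begin
      t ^ rk (clone k G [ B ]) * s ^ (∣ B ∣ ∸ rk (clone k G [ B ]))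
        ≡⟨ cong (λ r → t ^ r * s ^ (∣ B ∣ ∸ r)) (rk-clone k B G) ⟩
      t ^ r A * s ^ (∣ B ∣ ∸ r A)
        -- The nullity of `B` is the excess of `B` over its support plus the nullity of the support.
        ≡⟨ cong (λ i → t ^ r A * s ^ i) (∸-telescope (r≤ A) (∣support∣≤ n k B)) ⟩
      t ^ r A * s ^ (∣ B ∣ ∸ ∣ A ∣ ℕ.+ (∣ A ∣ ∸ r A))
        ≈⟨ *-congˡ (^-homo-* s (∣ B ∣ ∸ ∣ A ∣) _) ⟩
      t ^ r A * (s ^ (∣ B ∣ ∸ ∣ A ∣) * s ^ (∣ A ∣ ∸ r A))
        ≈⟨ x∙yz≈y∙xz _ _ _ ⟩
      s ^ (∣ B ∣ ∸ ∣ A ∣) * g A ∎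
      where
      A : Subset n
      A = support n k B

    collect : ∀ A → geometric k (1# + s) ^ ∣ A ∣ * g A ≈
                    (t * σ + 1# - 1#) ^ r A * (y ^ k - 1#) ^ (∣ A ∣ ∸ r A)
    collect A = begin
      geometric k (1# + s) ^ ∣ A ∣ * g A
        ≈⟨ *-congʳ (^-cong (geometric-cong k 1+s≈y) (≡.sym (ℕ.m+[n∸m]≡n (r≤ A)))) ⟩
      σ ^ (r A ℕ.+ (∣ A ∣ ∸ r A)) * g A
        ≈⟨ *-congʳ (^-homo-* σ (r A) _) ⟩
      σ ^ r A * σ ^ (∣ A ∣ ∸ r A) * (t ^ r A * s ^ (∣ A ∣ ∸ r A))
        ≈⟨ interchange _ _ _ _ ⟩
      σ ^ r A * t ^ r A * (σ ^ (∣ A ∣ ∸ r A) * s ^ (∣ A ∣ ∸ r A))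
        ≈⟨ *-cong (^-distrib-* σ t (r A)) (^-distrib-* σ s (∣ A ∣ ∸ r A)) ⟨
      (σ * t) ^ r A * (σ * s) ^ (∣ A ∣ ∸ r A)
        -- `q` subtracts 1 from its first argument, so `t * σ` is rewritten as `t * σ + 1# - 1#`.
        ≈⟨ *-cong (^-congˡ (r A) (trans (*-comm σ t) (sym (//-rightDividesʳ 1# (t * σ)))))
                  (^-congˡ (∣ A ∣ ∸ r A) σ*s≈y^k-1) ⟩
      (t * σ + 1# - 1#) ^ r A * (y ^ k - 1#) ^ (∣ A ∣ ∸ r A) ∎

-- Specialisation to the indeterminates

open import Algebra.Properties.Semiring.Exp (CommutativeRing.semiring ℤ[X,Y]) using (_^_)
open CommutativeRing ℤ[X,Y] using (_≈_; _+_; _*_; _-_; 1#)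
open GraphPolynomials ℤ[X,Y] using (P; q; geometric)

mainTheorem4 : ∀ {n : ℕ} (G : Graph n) (k : ℕ) → 1 ≤ k →
    (P (clone k G) X Y ≈ P G X ((1# + Y) ^ k - 1#)) ×
    (q (clone k G) X Y ≈ q G ((X - 1#) * geometric k Y + 1#) (Y ^ k))
mainTheorem4 G k _ = P-clone G k X Y , q-clone G k X Y
  where open CloneSums ℤ[X,Y] using (P-clone; q-clone)
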